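{- Let $\mathcal N$ and $\mathcal N'$ be two one-counter nets in normal form, with sets of control states $Q$ and $Q'$, and let $C$ be $1$ plus the maximal length of an acyclic path in the product graph of $\mathcal N$ and $\mathcal N'$ (so $C\le|Q\times Q'|$). Then for every pair $(q,q')\in Q\times Q'$ there is a positive vector $(\rho,\rho')\in\mathbb N^2$ such that: (1) if $(n,n')$ is $C$-above $(\rho,\rho')$ then $qn\preceq q'n'$; (2) if $(n,n')$ is $C$-below $(\rho,\rho')$ then $qn\not\preceq q'n'$; (3) $\rho,\rho'\le C$.
   Context: A one-counter net (OCN) $(Q,\mathrm{Act},\delta)$ has $\delta\subseteq Q\times\mathrm{Act}\times\{ -1,0,1\}\times Q$ and induces the LTS on $Q\times\mathbb N$ with $pm\xrightarrow{a}qn$ iff $(p,a,d,q)\in\delta$ and $n=m+d\ge0$. $\preceq$ denotes strong simulation preorder on the disjoint union of the two LTSs (the largest relation $R$ such that for $(c,c')\in R$ and $c\xrightarrow{a}d$ there is $c'\xrightarrow{a}d'$ with $(d,d')\in R$). Normal form: $\mathcal N$ is non-blocking (every state has an outgoing transition with counter effect in $\{0,1\}$) and $\mathcal N'$ is complete (every state has an outgoing transition for every action). The product graph of $\mathcal N=(Q,\mathrm{Act},\delta)$ and $\mathcal N'=(Q',\mathrm{Act},\delta')$ has nodes $Q\times Q'$ and an edge from $(p,p')$ to $(q,q')$ for each pair of transitions $t=(p,a,d,q)\in\delta$, $t'=(p',a,d',q')\in\delta'$ with the same label; the length of a path is its number of edges, and a path is acyclic if it visits no node twice. A vector $(\rho,\rho')\in\mathbb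 R^2$ is positive if $\rho\ge0$, $\rho'\ge0$ and $(\rho,\rho')\ne(0,0)$. For a positive vector $(\rho,\rho')$ and $c\in\mathbb R$, a point $(n,n')\in\mathbb Z^2$ is $c$-above $(\rho,\rho')$ if there is a real $r\ge0$ with $n<r\rho-c$ and $n'>r\rho'+c$, and $c$-below $(\rho,\rho')$ if there is a real $r\ge 0$ with $n>r\rho+c$ and $n'<r\rho'-c$. -}

module Defs where

open import Level using (Level) renaming (suc to lsuc; zero to lzero)
open import Data.Nat using (ℕ; zero; suc; _+_; _*_; _≤_; _<_)
open import Data.Fin using (Fin)
open import Data.List using (List; []; _∷_; length)
open import Data.List.Membership.Propositional using (_∈_)
open import Data.List.Relation.Unary.Unique.Propositional using (Unique)
open import Data.Product using (Σ; ∃; ∃-syntax; _×_; _,_; proj₁; proj₂)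
open import Data.Sum using (_⊎_)
open import Relation.Binary.PropositionalEquality using (_≡_)
open import Relation.Nullary using (¬_)

data Eff : Set where
  dec : Eff
  nop : Eff
  inc : Eff

record Trans (k m : ℕ) : Set where
  constructor tr
  field
    src   : Fin k
    label : Fin m
    eff   : Eff
    tgt   : Fin k
open Trans public

record OCN (k m : ℕ) : Set where
  constructor ocn
  field
    δ : List (Trans k m)
open OCN public

Apply : Eff → ℕ → ℕ → Set
Apply dec m n = m ≡ suc n
Apply nop m n = n ≡ m
Apply inc m n = n ≡ suc m

Conf : ℕ → Set
Conf k = Fin k × ℕ

Step : ∀ {k m} → OCN k m → Conf k → Fin m → Conf k → Set
Step N (p , x) a (q , y) =
  Σ (Trans _ _) λ t → t ∈ δ N × src t ≡ p × label t ≡ a × tgt t ≡ q × Apply (eff t) x y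

-- Strong simulation preorder between configurations of N and of N'
-- (the largest simulation = union of all simulations).  A relation
-- on the disjoint union relates configurations of N to those of N'
-- only through its N×N' part, which is itself a simulation.

IsSimulation : ∀ {k k' m} (N : OCN k m) (N' : OCN k' m) →
               (Conf k → Conf k' → Set) → Set
IsSimulation N N' R =
  ∀ c c' → R c c' → ∀ a d → Step N c a d →
  Σ (Conf _) λ d' → Step N' c' a d' × R d d'

Simulated : ∀ {k k' m} (N : OCN k m) (N' : OCN k' m) →
            Conf k → Conf k' → Set₁
Simulated N N' c c' =
  Σ (Conf _ → Conf _ → Set) λ R → IsSimulation N N' R × R c c'

NonBlocking : ∀ {k m} → OCN k m → Set
NonBlocking N =
  ∀ p → Σ (Trans _ _) λ t → t ∈ δ N × src t ≡ p × (eff t ≡ nop ⊎ eff t ≡ inc)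

Complete : ∀ {k m} → OCN k m → Set
Complete N = ∀ p a → Σ (Trans _ _) λ t → t ∈ δ N × src t ≡ p × label t ≡ a

Node : ℕ → ℕ → Set
Node k k' = Fin k × Fin k'

Edge : ∀ {k k' m} → OCN k m → OCN k' m → Node k k' → Node k k' → Set
Edge N N' (p , p') (q , q') =
  Σ (Trans _ _) λ t → Σ (Trans _ _) λ t' →
    t ∈ δ N × t' ∈ δ N' × label t ≡ label t' ×
    src t ≡ p × src t' ≡ p' × tgt t ≡ q × tgt t' ≡ q'

data IsPath {k k' m} (N : OCN k m) (N' : OCN k' m) : List (Node k k') → Set where
  single : ∀ v → IsPath N N' (v ∷ [])
  cons   : ∀ {v w vs} → Edge N N' v w → IsPath N N' (w ∷ vs) →
           IsPath N N' (v ∷ w ∷ vs)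

-- an acyclic path (no node visited twice) with L edges
AcyclicPathOfLength : ∀ {k k' m} → OCN k m → OCN k' m → ℕ → Set
AcyclicPathOfLength N N' L =
  Σ (List (Node _ _)) λ vs → IsPath N N' vs × Unique vs × length vs ≡ suc L

MaxAcyclicLength : ∀ {k k' m} → OCN k m → OCN k' m → ℕ → Set
MaxAcyclicLength N N' L =
  AcyclicPathOfLength N N' L × (∀ L' → AcyclicPathOfLength N N' L' → L' ≤ L)

-- Positive vectors and the c-above / c-below relations.
-- The paper quantifies over a real r ≥ 0; since the inequalities are
-- strict (an open condition) and ρ, ρ', c, n, n' are integers, this is
-- the same as quantifying over rationals r = a / (b+1) ≥ 0, and after
-- multiplying by b+1 > 0 all quantities are natural numbers.

Positive : ℕ → ℕ → Set
Positive ρ ρ' = ¬ (ρ ≡ 0 × ρ' ≡ 0)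

-- ∃ r = a/(b+1) ≥ 0 :  n < rρ - c  and  n' > rρ' + c
Above : (c ρ ρ' n n' : ℕ) → Set
Above c ρ ρ' n n' = ∃[ a ] ∃[ b ]
  ((n * suc b + c * suc b < a * ρ) × (a * ρ' + c * suc b < n' * suc b))

-- ∃ r = a/(b+1) ≥ 0 :  n > rρ + c  and  n' < rρ' - c
Below : (c ρ ρ' n n' : ℕ) → Set
Below c ρ ρ' n n' = ∃[ a ] ∃[ b ]
  ((a * ρ + c * suc b < n * suc b) × (n' * suc b + c * suc b < a * ρ'))

{-# OPTIONS --safe #-}
module Submission where

-- Fix a slope σ and let the players build a path in the product graph until it closes a
-- cycle; Spoiler wins if the effect of the cycle lies strictly below σ.  Playing such a
-- finite game over and over (forgetting the closed cycles) keeps the counters within an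
-- acyclic path, hence within C, of a base point that only drifts by cycle effects.
--
-- Order the finitely many slopes with entries at most C by steepness.  Spoiler's region for
-- a slope consists of the nodes of the region of the next flatter slope from which he wins
-- the first-cycle game without leaving that region.  The slope attached to (q , q') is the
-- flattest one whose region does not contain it, or (0 , 1) if there is none.
--  * Below ρ, Spoiler uses the strategy for the next flatter slope u: no cycle effect lies
--    strictly between u and ρ, so he stays below ρ, where his own counter cannot run out,
--    until he is C-below u; at the flattest slope nothing is left below.
--  * Above ρ, Duplicator keeps the base point above ρ.  If Spoiler's region for u is left,
--    Duplicator passes to a flatter slope.  The nodes of different phases are disjoint, so
--    the whole path stays acyclic and the single margin C suffices.

open import Defs
open import Level using (0ℓ)
open import Data.Nat using (ℕ; zero; suc; _≤_; z≤n; s≤s)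
import Data.Nat as ℕ
import Data.Nat.Properties as ℕₚ
open import Data.Integer using (ℤ; +_; -[1+_]; 0ℤ; 1ℤ; -1ℤ; ∣_∣; _+_; _-_; _*_; -_; +≤+)
import Data.Integer as ℤ
import Data.Integer.Properties as ℤₚ
open import Data.Integer.Tactic.RingSolver using (solve-∀)
import Data.Nat.Tactic.RingSolver as ℕSolver
open import Data.Fin using (Fin)
import Data.Fin as Fin
open import Data.List using (List; []; _∷_; _++_; length; map; _ʳ++_; reverse; upTo; cartesianProduct)
import Data.List.Properties as Listₚ
open import Data.List.Membership.Propositional using (_∈_; find; lose)
open import Data.List.Membership.Propositional.Properties using (∈-cartesianProduct⁺; ∈-cartesianProduct⁻; ∈-upTo⁺; ∈-upTo⁻)
open import Data.List.Relation.Unary.Any using (Any; here; there; any?)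
open import Data.List.Relation.Unary.All using (All; []; _∷_; all?; lookup)
import Data.List.Relation.Unary.All as All
open import Data.List.Relation.Unary.All.Properties using (¬All⇒Any¬; ¬Any⇒All¬; All¬⇒¬Any) renaming (map⁺ to All-map⁺; ++⁺ to All-++⁺)
open import Data.List.Relation.Unary.AllPairs using (AllPairs; []; _∷_)
open import Data.List.Relation.Unary.Linked using (Linked; []; [-]; _∷_)
open import Data.List.Relation.Unary.Linked.Properties using (Linked⇒AllPairs)
open import Data.List.Relation.Unary.Unique.Propositional using (Unique)
open import Data.List.Relation.Unary.Unique.Propositional.Properties using () renaming (++⁺ to Unique-++⁺)
import Data.List.Sort as Sort
open import Data.List.Relation.Binary.Permutation.Propositional using (↭⇒↭ₛ; ↭-sym)
open import Data.List.Relation.Binary.Permutation.Propositional.Properties using (↭-reverse; ∈-resp-↭)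
import Data.List.Relation.Binary.Permutation.Setoid.Properties as PermutationSetoid
import Data.Rational.Unnormalised as ℚᵘ
import Data.Rational.Unnormalised.Properties as ℚᵘₚ
open import Data.Product using (Σ; ∃-syntax; _×_; _,_; proj₁; proj₂)
open import Data.Product.Properties using (≡-dec)
open import Data.Sum using (_⊎_; inj₁; inj₂)
open import Data.Unit using (⊤; tt)
open import Data.Empty using (⊥; ⊥-elim)
open import Function using (_∘_)
open import Relation.Binary.Bundles using (DecTotalOrder)
import Relation.Binary.Construct.Flip.EqAndOrd as Flip
import Relation.Binary.Construct.On as On
open import Relation.Binary.PropositionalEquality using (_≡_; _≢_; refl; sym; trans; cong; cong₂; subst; setoid)
open import Relation.Nullary using (¬_; Dec; yes; no)
open import Relation.Nullary.Decidable using (_×-dec_; _→-dec_; ¬?)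
open import Relation.Unary using (Decidable)

-- Integer inequalities, plane vectors and slopes

0≤-+ : ∀ {i j} → 0ℤ ℤ.≤ i → 0ℤ ℤ.≤ j → 0ℤ ℤ.≤ i + j
0≤-+ = ℤₚ.+-mono-≤

0≤-* : ∀ {i j} → 0ℤ ℤ.≤ i → 0ℤ ℤ.≤ j → 0ℤ ℤ.≤ i * j
0≤-* {+ m} {+ n} _ _ = subst (0ℤ ℤ.≤_) (ℤₚ.pos-* m n) (+≤+ z≤n)

0≤+ : ∀ n → 0ℤ ℤ.≤ + n
0≤+ n = +≤+ z≤n

≤-by : ∀ {i j e} → j - i ≡ e → 0ℤ ℤ.≤ e → i ℤ.≤ j
≤-by eq 0≤e = ℤₚ.0≤i-j⇒j≤i (subst (0ℤ ℤ.≤_) (sym eq) 0≤e)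

<-by : ∀ {i j e} → j - i - 1ℤ ≡ e → 0ℤ ℤ.≤ e → i ℤ.< j
<-by {i} {j} eq 0≤e = ℤₚ.suc[i]≤j⇒i<j (≤-by (trans (rearrange i j) eq) 0≤e)
  where
  rearrange : ∀ i j → j - (1ℤ + i) ≡ j - i - 1ℤ
  rearrange = solve-∀

<⇒0≤ : ∀ {i j} → i ℤ.< j → 0ℤ ℤ.≤ j - i - 1ℤ
<⇒0≤ {i} {j} i<j = subst (0ℤ ℤ.≤_) (rearrange i j) (ℤₚ.i≤j⇒0≤j-i (ℤₚ.i<j⇒suc[i]≤j i<j))
  where
  rearrange : ∀ i j → j - (1ℤ + i) ≡ j - i - 1ℤ
  rearrange = solve-∀

i≤+∣i∣ : ∀ i → i ℤ.≤ + ∣ i ∣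
i≤+∣i∣ (+ n) = ℤₚ.≤-refl
i≤+∣i∣ -[1+ n ] = ℤ.-≤+

∣i∣≤k⇒0≤k-i : ∀ {k} i → ∣ i ∣ ≤ k → 0ℤ ℤ.≤ + k - i
∣i∣≤k⇒0≤k-i i le = ℤₚ.i≤j⇒0≤j-i (ℤₚ.≤-trans (i≤+∣i∣ i) (+≤+ le))

∣i∣≤k⇒0≤k+i : ∀ {k} i → ∣ i ∣ ≤ k → 0ℤ ℤ.≤ + k + i
∣i∣≤k⇒0≤k+i {k} i le = subst (λ j → 0ℤ ℤ.≤ + k + j) (ℤₚ.neg-involutive i)
  (∣i∣≤k⇒0≤k-i (- i) (subst (_≤ k) (sym (ℤₚ.∣-i∣≡∣i∣ i)) le))

Vec² : Set
Vec² = ℤ × ℤ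

0v : Vec²
0v = 0ℤ , 0ℤ

infixl 6 _⊕_ _⊖_

_⊕_ _⊖_ : Vec² → Vec² → Vec²
(x , y) ⊕ (x′ , y′) = x + x′ , y + y′
(x , y) ⊖ (x′ , y′) = x - x′ , y - y′

⊕-identityʳ : ∀ p → p ⊕ 0v ≡ p
⊕-identityʳ (x , y) = cong₂ _,_ (ℤₚ.+-identityʳ x) (ℤₚ.+-identityʳ y)

⊕-identityˡ : ∀ p → 0v ⊕ p ≡ p
⊕-identityˡ (x , y) = cong₂ _,_ (ℤₚ.+-identityˡ x) (ℤₚ.+-identityˡ y)

⊕-assoc : ∀ p q r → p ⊕ q ⊕ r ≡ p ⊕ (q ⊕ r)
⊕-assoc (x , y) (x′ , y′) (x″ , y″) = cong₂ _,_ (ℤₚ.+-assoc x x′ x″) (ℤₚ.+-assoc y y′ y″)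

p⊖q⊕q≡p : ∀ p q → p ⊖ q ⊕ q ≡ p
p⊖q⊕q≡p (x , y) (x′ , y′) = cong₂ _,_ (eq x x′) (eq y y′)
  where
  eq : ∀ i j → i - j + j ≡ i
  eq = solve-∀

p⊕d⊖q≡[p⊖q]⊕d : ∀ p d q → p ⊕ d ⊖ q ≡ (p ⊖ q) ⊕ d
p⊕d⊖q≡[p⊖q]⊕d (x , y) (a , b) (x′ , y′) = cong₂ _,_ (eq x a x′) (eq y b y′)
  where
  eq : ∀ i a j → i + a - j ≡ i - j + a
  eq = solve-∀

p⊖p≡0 : ∀ p → p ⊖ p ≡ 0v
p⊖p≡0 (x , y) = cong₂ _,_ (ℤₚ.+-inverseʳ x) (ℤₚ.+-inverseʳ y)

p⊖q⊕q⊖r≡p⊖r : ∀ p q r → (p ⊖ q) ⊕ (q ⊖ r) ≡ p ⊖ r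
p⊖q⊕q⊖r≡p⊖r (x , y) (x′ , y′) (x″ , y″) = cong₂ _,_ (eq x x′ x″) (eq y y′ y″)
  where
  eq : ∀ i j k → i - j + (j - k) ≡ i - k
  eq = solve-∀

⊕-regroup : ∀ b s a x → b ⊕ (s ⊕ (a ⊕ x)) ≡ b ⊕ a ⊕ (s ⊕ x)
⊕-regroup (b , b′) (s , s′) (a , a′) (x , x′) = cong₂ _,_ (eq b s a x) (eq b′ s′ a′ x′)
  where
  eq : ∀ b s a x → b + (s + (a + x)) ≡ b + a + (s + x)
  eq = solve-∀

p⊕d⊖p≡d : ∀ p d → p ⊕ d ⊖ p ≡ d
p⊕d⊖p≡d (x , y) (a , b) = cong₂ _,_ (eq x a) (eq y b)
  where
  eq : ∀ i a → i + a - i ≡ a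
  eq = solve-∀

Small : ℕ → Vec² → Set
Small k (x , y) = ∣ x ∣ ≤ k × ∣ y ∣ ≤ k

Small-⊕ : ∀ {j k} p q → Small j p → Small k q → Small (j ℕ.+ k) (p ⊕ q)
Small-⊕ (x , y) (x′ , y′) (a , b) (a′ , b′) =
  ℕₚ.≤-trans (ℤₚ.∣i+j∣≤∣i∣+∣j∣ x x′) (ℕₚ.+-mono-≤ a a′) ,
  ℕₚ.≤-trans (ℤₚ.∣i+j∣≤∣i∣+∣j∣ y y′) (ℕₚ.+-mono-≤ b b′)

Small-mono : ∀ {j k} p → j ≤ k → Small j p → Small k p
Small-mono p j≤k (a , b) = ℕₚ.≤-trans a j≤k , ℕₚ.≤-trans b j≤k

Slope : Set
Slope = ℕ × ℕ

weight : Slope → ℕ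
weight (a , b) = a ℕ.+ b

-- Negative when p lies on the flat side of the line through σ, positive on the steep side.
cross : Slope → Vec² → ℤ
cross (a , b) (x , y) = + a * y - + b * x

cross-⊕ : ∀ σ p q → cross σ (p ⊕ q) ≡ cross σ p + cross σ q
cross-⊕ (a , b) (x , y) (x′ , y′) = eq (+ a) (+ b) x y x′ y′
  where
  eq : ∀ a b x y x′ y′ → a * (y + y′) - b * (x + x′) ≡ (a * y - b * x) + (a * y′ - b * x′)
  eq = solve-∀

cross-0v : ∀ σ → cross σ 0v ≡ 0ℤ
cross-0v (a , b) = eq (+ a) (+ b)
  where
  eq : ∀ a b → a * 0ℤ - b * 0ℤ ≡ 0ℤ
  eq = solve-∀

∣cross∣≤ : ∀ {k} σ p → Small k p → ∣ cross σ p ∣ ≤ k ℕ.* weight σ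
∣cross∣≤ {k} (a , b) (x , y) (x≤k , y≤k) = begin
  ∣ + a * y - + b * x ∣             ≤⟨ ℤₚ.∣i-j∣≤∣i∣+∣j∣ (+ a * y) (+ b * x) ⟩
  ∣ + a * y ∣ ℕ.+ ∣ + b * x ∣       ≡⟨ cong₂ ℕ._+_ (ℤₚ.abs-* (+ a) y) (ℤₚ.abs-* (+ b) x) ⟩
  a ℕ.* ∣ y ∣ ℕ.+ b ℕ.* ∣ x ∣       ≤⟨ ℕₚ.+-mono-≤ (ℕₚ.*-monoʳ-≤ a y≤k) (ℕₚ.*-monoʳ-≤ b x≤k) ⟩
  a ℕ.* k ℕ.+ b ℕ.* k               ≡⟨ ℕₚ.*-distribʳ-+ k a b ⟨
  (a ℕ.+ b) ℕ.* k                   ≡⟨ ℕₚ.*-comm (a ℕ.+ b) k ⟩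
  k ℕ.* (a ℕ.+ b)                   ∎
  where open ℕₚ.≤-Reasoning

⟦_⟧ : Eff → ℤ
⟦ dec ⟧ = -1ℤ
⟦ nop ⟧ = 0ℤ
⟦ inc ⟧ = 1ℤ

∣⟦_⟧∣≤1 : ∀ e → ∣ ⟦ e ⟧ ∣ ≤ 1
∣⟦ dec ⟧∣≤1 = ℕₚ.≤-refl
∣⟦ nop ⟧∣≤1 = z≤n
∣⟦ inc ⟧∣≤1 = ℕₚ.≤-refl

Apply⇒+ : ∀ e {m n} → Apply e m n → + n ≡ + m + ⟦ e ⟧
Apply⇒+ dec refl = refl
Apply⇒+ nop {m} refl = sym (ℤₚ.+-identityʳ (+ m))
Apply⇒+ inc {m} refl = cong +_ (ℕₚ.+-comm 1 m)

+⇒Apply : ∀ e m → 0ℤ ℤ.≤ + m + ⟦ e ⟧ → ∃[ n ] Apply e m n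
+⇒Apply dec (suc m) _ = m , refl
+⇒Apply nop m _ = m , refl
+⇒Apply inc m _ = suc m , refl

-- Comparing slopes by steepness

infix 4 _≼_

-- Cross-multiplied, so that the vertical slope is included as the steepest one. The pair `(0 , 0)`
-- is comparable with everything, which is why transitivity asks for a positive middle slope.
_≼_ : Slope → Slope → Set
(a , b) ≼ (a′ , b′) = b ℕ.* a′ ≤ a ℕ.* b′

IsPositive : Slope → Set
IsPositive (a , b) = Positive a b

≼-trans : ∀ u v w → IsPositive v → u ≼ v → v ≼ w → u ≼ w
≼-trans (a , b) (zero , zero) w pos _ _ = ⊥-elim (pos (refl , refl))
≼-trans (a , b) (zero , suc d) (zero , f) pos _ _ = subst (_≤ a ℕ.* f) (sym (ℕₚ.*-zeroʳ b)) z≤n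
≼-trans (a , b) (suc c , d) (e , f) pos u≼v v≼w = ℕₚ.*-cancelˡ-≤ (suc c) (begin
  suc c ℕ.* (b ℕ.* e)   ≡⟨ ℕₚ.*-assoc (suc c) b e ⟨
  suc c ℕ.* b ℕ.* e     ≡⟨ cong (ℕ._* e) (ℕₚ.*-comm (suc c) b) ⟩
  b ℕ.* suc c ℕ.* e     ≤⟨ ℕₚ.*-monoˡ-≤ e u≼v ⟩
  a ℕ.* d ℕ.* e         ≡⟨ ℕₚ.*-assoc a d e ⟩
  a ℕ.* (d ℕ.* e)       ≤⟨ ℕₚ.*-monoʳ-≤ a v≼w ⟩
  a ℕ.* (suc c ℕ.* f)   ≡⟨ ℕₚ.*-assoc a (suc c) f ⟨
  a ℕ.* suc c ℕ.* f     ≡⟨ cong (ℕ._* f) (ℕₚ.*-comm a (suc c)) ⟩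
  suc c ℕ.* a ℕ.* f     ≡⟨ ℕₚ.*-assoc (suc c) a f ⟩
  suc c ℕ.* (a ℕ.* f)   ∎)
  where open ℕₚ.≤-Reasoning

cross-+ : ∀ a b x y → cross (a , b) (+ x , + y) ≡ + (a ℕ.* y) - + (b ℕ.* x)
cross-+ a b x y = cong₂ _-_ (sym (ℤₚ.pos-* a y)) (sym (ℤₚ.pos-* b x))

cross-neg : ∀ a b x y → cross (a , b) (-[1+ x ] , -[1+ y ]) ≡ + (b ℕ.* suc x) - + (a ℕ.* suc y)
cross-neg a b x y = trans (eq (+ a) (+ b) (+ suc x) (+ suc y)) (cong₂ _-_ (sym (ℤₚ.pos-* b (suc x))) (sym (ℤₚ.pos-* a (suc y))))
  where
  eq : ∀ a b x y → a * (- y) - b * (- x) ≡ b * x - a * y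
  eq = solve-∀

i-j<0⇒i<j : ∀ {m n} → + m - + n ℤ.< 0ℤ → m ℕ.< n
i-j<0⇒i<j {m} {n} lt = ℤₚ.drop‿+<+ (<-by (eq (+ m) (+ n)) (<⇒0≤ lt))
  where
  eq : ∀ i j → j - i - 1ℤ ≡ 0ℤ - (i - j) - 1ℤ
  eq = solve-∀

≼⇒cross≤0 : ∀ u ρ x y → u ≼ ρ → cross u (+ x , + y) ℤ.< 0ℤ → cross ρ (+ x , + y) ℤ.≤ 0ℤ
≼⇒cross≤0 (a′ , b′) (a , b) x y u≼ρ neg =
  subst (ℤ._≤ 0ℤ) (sym (cross-+ a b x y)) (ℤₚ.i≤j⇒i-j≤0
    (+≤+ (goal a′ b′ a u≼ρ (i-j<0⇒i<j (subst (ℤ._< 0ℤ) (cross-+ a′ b′ x y) neg)))))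
  where
  open ℕₚ.≤-Reasoning

  goal : ∀ a′ b′ a → b′ ℕ.* a ≤ a′ ℕ.* b → a′ ℕ.* y ℕ.< b′ ℕ.* x → a ℕ.* y ≤ b ℕ.* x
  -- A vertical `u` forces `ρ` to be vertical as well.
  goal zero (suc b′) zero _ _ = z≤n
  goal (suc a′) b′ a le lt = ℕₚ.*-cancelˡ-≤ (suc a′) (begin
    suc a′ ℕ.* (a ℕ.* y)   ≡⟨ ℕₚ.*-assoc (suc a′) a y ⟨
    suc a′ ℕ.* a ℕ.* y     ≡⟨ cong (ℕ._* y) (ℕₚ.*-comm (suc a′) a) ⟩
    a ℕ.* suc a′ ℕ.* y     ≡⟨ ℕₚ.*-assoc a (suc a′) y ⟩
    a ℕ.* (suc a′ ℕ.* y)   ≤⟨ ℕₚ.*-monoʳ-≤ a (ℕₚ.<⇒≤ lt) ⟩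
    a ℕ.* (b′ ℕ.* x)       ≡⟨ ℕₚ.*-assoc a b′ x ⟨
    a ℕ.* b′ ℕ.* x         ≡⟨ cong (ℕ._* x) (ℕₚ.*-comm a b′) ⟩
    b′ ℕ.* a ℕ.* x         ≤⟨ ℕₚ.*-monoˡ-≤ x le ⟩
    suc a′ ℕ.* b ℕ.* x     ≡⟨ ℕₚ.*-assoc (suc a′) b x ⟩
    suc a′ ℕ.* (b ℕ.* x)   ∎)

-- The negative quadrant is the only one in which a vector can lie strictly
-- below u and strictly above ρ, and then its opposite is a slope between the two.
cross-gap : ∀ u ρ α → u ≼ ρ →
  (∀ x y → suc x ≤ ∣ proj₁ α ∣ → suc y ≤ ∣ proj₂ α ∣ → ρ ≼ (suc x , suc y) ⊎ (suc x , suc y) ≼ u) →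
  cross u α ℤ.< 0ℤ → cross ρ α ℤ.≤ 0ℤ
cross-gap u ρ (+ x , + y) u≼ρ _ neg = ≼⇒cross≤0 u ρ x y u≼ρ neg
cross-gap u (a , b) (+ x , -[1+ y ]) _ _ _ =
  ≤-by (eq (+ a) (+ b) (+ x) (+ suc y)) (0≤-+ (0≤-* (0≤+ a) (0≤+ (suc y))) (0≤-* (0≤+ b) (0≤+ x)))
  where
  eq : ∀ a b x y → 0ℤ - (a * (- y) - b * x) ≡ a * y + b * x
  eq = solve-∀
cross-gap (a , b) ρ (-[1+ x ] , + y) _ _ neg = ⊥-elim (ℤₚ.<⇒≱ neg
  (≤-by (eq (+ a) (+ b) (+ suc x) (+ y)) (0≤-+ (0≤-* (0≤+ a) (0≤+ y)) (0≤-* (0≤+ b) (0≤+ (suc x))))))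
  where
  eq : ∀ a b x y → a * y - b * (- x) - 0ℤ ≡ a * y + b * x
  eq = solve-∀
cross-gap (a′ , b′) (a , b) (-[1+ x ] , -[1+ y ]) _ gap neg with gap x y ℕₚ.≤-refl ℕₚ.≤-refl
... | inj₁ ρ≼c = subst (ℤ._≤ 0ℤ) (sym (cross-neg a b x y)) (ℤₚ.i≤j⇒i-j≤0 (+≤+ ρ≼c))
... | inj₂ c≼u = ⊥-elim (ℕₚ.<⇒≱
  (i-j<0⇒i<j (subst (ℤ._< 0ℤ) (cross-neg a′ b′ x y) neg))
  (subst (_≤ b′ ℕ.* suc x) (ℕₚ.*-comm (suc y) a′) (subst (suc y ℕ.* a′ ≤_) (ℕₚ.*-comm (suc x) b′) c≼u)))

-- Strips around a line

¬Above-vertical : ∀ c ρ' n n' → ¬ Above c 0 ρ' n n'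
¬Above-vertical c ρ' n n' (a , b , lt , _) =
  ℕₚ.n≮0 (subst (n ℕ.* suc b ℕ.+ c ℕ.* suc b ℕ.<_) (ℕₚ.*-zeroʳ a) lt)

-- Scaling the two inequalities by `ρ'` and `ρ` makes the parameter `r` occur only in `r * ρ * ρ'`,
-- which cancels. Strictness survives because `ρ` is nonzero; for `ρ` zero no point is above.
Above⇒< : ∀ c ρ ρ' n n' → Above c ρ ρ' n n' → (n ℕ.+ c) ℕ.* ρ' ℕ.+ c ℕ.* ρ ℕ.< n' ℕ.* ρ
Above⇒< c zero ρ' n n' above = ⊥-elim (¬Above-vertical c ρ' n n' above)
Above⇒< c ρ@(suc _) ρ' n n' (a , b , lt , lt′) = ℕₚ.*-cancelʳ-< (suc b) _ _ (begin-strict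
  ((n ℕ.+ c) ℕ.* ρ' ℕ.+ c ℕ.* ρ) ℕ.* suc b             ≡⟨ regroup n c ρ ρ' (suc b) ⟩
  ρ' ℕ.* (n ℕ.* suc b ℕ.+ c ℕ.* suc b) ℕ.+ ρ ℕ.* (c ℕ.* suc b)
                                                       ≤⟨ ℕₚ.+-monoˡ-≤ _ (ℕₚ.*-monoʳ-≤ ρ' (ℕₚ.<⇒≤ lt)) ⟩
  ρ' ℕ.* (a ℕ.* ρ) ℕ.+ ρ ℕ.* (c ℕ.* suc b)             ≡⟨ factor a ρ ρ' (c ℕ.* suc b) ⟩
  ρ ℕ.* (a ℕ.* ρ' ℕ.+ c ℕ.* suc b)                     <⟨ ℕₚ.*-monoʳ-< ρ lt′ ⟩
  ρ ℕ.* (n' ℕ.* suc b)                                 ≡⟨ swap ρ n' (suc b) ⟩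
  n' ℕ.* ρ ℕ.* suc b                                   ∎)
  where
  open ℕₚ.≤-Reasoning
  regroup : ∀ n c ρ ρ' B → ((n ℕ.+ c) ℕ.* ρ' ℕ.+ c ℕ.* ρ) ℕ.* B ≡ ρ' ℕ.* (n ℕ.* B ℕ.+ c ℕ.* B) ℕ.+ ρ ℕ.* (c ℕ.* B)
  regroup = ℕSolver.solve-∀
  factor : ∀ a ρ ρ' D → ρ' ℕ.* (a ℕ.* ρ) ℕ.+ ρ ℕ.* D ≡ ρ ℕ.* (a ℕ.* ρ' ℕ.+ D)
  factor = ℕSolver.solve-∀
  swap : ∀ ρ n B → ρ ℕ.* (n ℕ.* B) ≡ n ℕ.* ρ ℕ.* B
  swap = ℕSolver.solve-∀

<⇒cross : ∀ c ρ ρ' n n' → (n ℕ.+ c) ℕ.* ρ' ℕ.+ c ℕ.* ρ ℕ.< n' ℕ.* ρ →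
          + (c ℕ.* (ρ ℕ.+ ρ')) ℤ.< + (ρ ℕ.* n') - + (ρ' ℕ.* n)
<⇒cross c ρ ρ' n n' lt =
  subst (ℤ._< _) (cancel (+ (c ℕ.* (ρ ℕ.+ ρ'))) (+ (ρ' ℕ.* n)))
    (ℤₚ.+-monoˡ-< (- + (ρ' ℕ.* n)) (ℤ.+<+ (subst (ℕ._< ρ ℕ.* n') (eq n c ρ ρ')
      (subst ((n ℕ.+ c) ℕ.* ρ' ℕ.+ c ℕ.* ρ ℕ.<_) (ℕₚ.*-comm n' ρ) lt))))
  where
  eq : ∀ n c ρ ρ' → (n ℕ.+ c) ℕ.* ρ' ℕ.+ c ℕ.* ρ ≡ c ℕ.* (ρ ℕ.+ ρ') ℕ.+ ρ' ℕ.* n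
  eq = ℕSolver.solve-∀
  cancel : ∀ i j → i + j - j ≡ i
  cancel = solve-∀

-- An offset with entries at most `c` changes `cross ρ` by at most `c * weight ρ`, so these say that
-- the whole square of radius `c` around `p` lies strictly on one side of the line.
AboveLine BelowLine : ℕ → Slope → Vec² → Set
AboveLine c ρ p = + (c ℕ.* weight ρ) ℤ.< cross ρ p
BelowLine c ρ p = cross ρ p ℤ.< - + (c ℕ.* weight ρ)

Above⇒AboveLine : ∀ c ρ ρ' n n' → Above c ρ ρ' n n' → AboveLine c (ρ , ρ') (+ n , + n')
Above⇒AboveLine c ρ ρ' n n' above =
  subst (_ ℤ.<_) (sym (cross-+ ρ ρ' n n')) (<⇒cross c ρ ρ' n n' (Above⇒< c ρ ρ' n n' above))

-- Swapping the coordinates turns `Below` into `Above` and negates `cross`.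
Below⇒BelowLine : ∀ c ρ ρ' n n' → Below c ρ ρ' n n' → BelowLine c (ρ , ρ') (+ n , + n')
Below⇒BelowLine c ρ ρ' n n' (a , b , lt , lt′) =
  subst (ℤ._< _) (trans (opposite (+ (ρ' ℕ.* n)) (+ (ρ ℕ.* n'))) (sym (cross-+ ρ ρ' n n')))
    (subst (λ w → - (+ (ρ' ℕ.* n) - + (ρ ℕ.* n')) ℤ.< - + (c ℕ.* w)) (ℕₚ.+-comm ρ' ρ)
      (ℤₚ.neg-mono-< (<⇒cross c ρ' ρ n' n (Above⇒< c ρ' ρ n' n (a , b , lt′ , lt)))))
  where
  opposite : ∀ i j → - (i - j) ≡ j - i
  opposite = solve-∀

0<a*i⇒0<i : ∀ a {i} → 0ℤ ℤ.< + a * i → 0ℤ ℤ.< i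
0<a*i⇒0<i a {i} lt = ℤₚ.*-cancelˡ-<-nonNeg (+ a) (subst (ℤ._< + a * i) (sym (ℤₚ.*-zeroʳ (+ a))) lt)

-- The offset cannot carry the point across the line, so `a * y > b * x ≥ 0` where it ends. Hence
-- Duplicator can answer any move that Spoiler's counter allows.
AboveLine⇒0≤y : ∀ {c} ρ base s → AboveLine c ρ base → Small c s →
                0ℤ ℤ.≤ proj₁ (base ⊕ s) → 0ℤ ℤ.≤ proj₂ (base ⊕ s)
AboveLine⇒0≤y {c} ρ@(a , b) base s above small 0≤x = ℤₚ.<⇒≤ (0<a*i⇒0<i a
  (<-by (eq (+ a) (+ b) (proj₁ (base ⊕ s)) (proj₂ (base ⊕ s)))
    (0≤-+ (subst (0ℤ ℤ.≤_) (cong (_- 1ℤ) (sym (cross-⊕ ρ base s)))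
             (subst (0ℤ ℤ.≤_) (eq′ (cross ρ base) (cross ρ s) (+ (c ℕ.* weight ρ)))
               (0≤-+ (<⇒0≤ above) (∣i∣≤k⇒0≤k+i (cross ρ s) (∣cross∣≤ ρ s small)))))
          (0≤-* (0≤+ b) 0≤x))))
  where
  eq : ∀ a b x y → a * y - 0ℤ - 1ℤ ≡ (a * y - b * x - 1ℤ) + b * x
  eq = solve-∀
  eq′ : ∀ p s W → (p - W - 1ℤ) + (W + s) ≡ p + s - 1ℤ
  eq′ = solve-∀

-- The hypothesis rearranges to `b * (x - c) > a * (y + c)`. It leaves Spoiler's counter room for
-- every offset up to `c`.
BelowLine⇒c<x : ∀ {c} ρ base → BelowLine c ρ base → 0ℤ ℤ.≤ proj₂ base + + c → 0ℤ ℤ.< proj₁ base - + c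
BelowLine⇒c<x {c} (a , b) (x , y) below 0≤y+c = 0<a*i⇒0<i b
  (<-by (eq (+ a) (+ b) x y (+ c))
    (0≤-+ (subst (λ W → 0ℤ ℤ.≤ - W - (+ a * y - + b * x) - 1ℤ) (ℤₚ.pos-* c (a ℕ.+ b)) (<⇒0≤ below))
          (0≤-* (0≤+ a) 0≤y+c)))
  where
  eq : ∀ a b x y c → b * (x - c) - 0ℤ - 1ℤ ≡ (- (c * (a + b)) - (a * y - b * x) - 1ℤ) + a * (y + c)
  eq = solve-∀

-- With `X = x + c` and `Y = y - c`, being above reads `b * X < a * Y`. As `X` is nonnegative, `Y`
-- is positive, and in that quadrant a point above a line is above every flatter one.
AboveLine-≼ : ∀ {c} u ρ base → IsPositive u → u ≼ ρ → 0ℤ ℤ.≤ proj₁ base + + c →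
              AboveLine c ρ base → AboveLine c u base
AboveLine-≼ {c} u@(a′ , b′) ρ@(a , b) (x , y) pos u≼ρ 0≤x+c above =
  from u (natural (x + + c) (y - + c) 0≤x+c
    (0<a*i⇒0<i a (<-by (eq (+ a) (+ b) (x + + c) (y - + c)) (0≤-+ (<⇒0≤ (to ρ above)) (0≤-* (0≤+ b) 0≤x+c))))
    (to ρ above))
  where
  eq : ∀ a b X Y → a * Y - 0ℤ - 1ℤ ≡ (a * Y - b * X - 1ℤ) + b * X
  eq = solve-∀

  shift : ∀ a b x y c → (a * y - b * x) - c * (a + b) - 1ℤ ≡ a * (y - c) - b * (x + c) - 1ℤ
  shift = solve-∀

  unfold : ∀ (τ : Slope) → cross τ (x , y) - + (c ℕ.* weight τ) - 1ℤ ≡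
                           + proj₁ τ * (y - + c) - + proj₂ τ * (x + + c) - 1ℤ
  unfold (d , e) = trans (cong (λ W → cross (d , e) (x , y) - W - 1ℤ) (ℤₚ.pos-* c (d ℕ.+ e))) (shift (+ d) (+ e) x y (+ c))

  to : ∀ τ → AboveLine c τ (x , y) → + proj₂ τ * (x + + c) ℤ.< + proj₁ τ * (y - + c)
  to τ lt = <-by (sym (unfold τ)) (<⇒0≤ lt)

  from : ∀ τ → + proj₂ τ * (x + + c) ℤ.< + proj₁ τ * (y - + c) → AboveLine c τ (x , y)
  from τ lt = <-by (unfold τ) (<⇒0≤ lt)

  open ℕₚ.≤-Reasoning

  core : ∀ a′ b′ a X Y → ¬ (a′ ≡ 0 × b′ ≡ 0) → b′ ℕ.* a ≤ a′ ℕ.* b →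
         b ℕ.* X ℕ.< a ℕ.* Y → b′ ℕ.* X ℕ.< a′ ℕ.* Y
  core zero zero a X Y pos _ _ = ⊥-elim (pos (refl , refl))
  core zero (suc b′) zero X Y _ _ ()
  core (suc a′) b′ zero X Y _ _ ()
  core (suc a′) b′ (suc a) X Y _ le lt = ℕₚ.*-cancelˡ-< (suc a) _ _ (begin-strict
    suc a ℕ.* (b′ ℕ.* X)     ≡⟨ ℕₚ.*-assoc (suc a) b′ X ⟨
    suc a ℕ.* b′ ℕ.* X       ≡⟨ cong (ℕ._* X) (ℕₚ.*-comm (suc a) b′) ⟩
    b′ ℕ.* suc a ℕ.* X       ≤⟨ ℕₚ.*-monoˡ-≤ X le ⟩
    suc a′ ℕ.* b ℕ.* X       ≡⟨ ℕₚ.*-assoc (suc a′) b X ⟩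
    suc a′ ℕ.* (b ℕ.* X)     <⟨ ℕₚ.*-monoʳ-< (suc a′) lt ⟩
    suc a′ ℕ.* (suc a ℕ.* Y) ≡⟨ ℕₚ.*-assoc (suc a′) (suc a) Y ⟨
    suc a′ ℕ.* suc a ℕ.* Y   ≡⟨ cong (ℕ._* Y) (ℕₚ.*-comm (suc a′) (suc a)) ⟩
    suc a ℕ.* suc a′ ℕ.* Y   ≡⟨ ℕₚ.*-assoc (suc a) (suc a′) Y ⟩
    suc a ℕ.* (suc a′ ℕ.* Y) ∎)

  natural : ∀ X Y → 0ℤ ℤ.≤ X → 0ℤ ℤ.< Y → + b * X ℤ.< + a * Y → + b′ * X ℤ.< + a′ * Y
  natural (+ X) (+ Y) _ _ lt
    rewrite sym (ℤₚ.pos-* b X) | sym (ℤₚ.pos-* a Y) | sym (ℤₚ.pos-* b′ X) | sym (ℤₚ.pos-* a′ Y) =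
    ℤ.+<+ (core a′ b′ a X Y pos u≼ρ (ℤₚ.drop‿+<+ lt))

-- (a , b) encodes the slope (1 + a , b), so that b / (1 + a) orders the codes.
slope : ℕ × ℕ → Slope
slope (a , b) = suc a , b

fraction : ℕ × ℕ → ℚᵘ.ℚᵘ
fraction (a , b) = ℚᵘ.mkℚᵘ (+ b) a

steepest-first : DecTotalOrder 0ℓ 0ℓ 0ℓ
steepest-first = Flip.decTotalOrder (On.decTotalOrder ℚᵘₚ.≤-decTotalOrder fraction)

open DecTotalOrder steepest-first using () renaming (_≤_ to _⊒_; trans to ⊒-trans)
open Sort steepest-first using (sort; sort-↭; sort-↗)

⊒⇒≼ : ∀ {c d} → c ⊒ d → slope d ≼ slope c
⊒⇒≼ {a , b} {a′ , b′} (ℚᵘ.*≤* le) = subst (b′ ℕ.* suc a ≤_) (ℕₚ.*-comm b (suc a′))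
  (ℤₚ.drop‿+≤+ (subst (ℤ._≤ + (b ℕ.* suc a′)) (sym (ℤₚ.pos-* b′ (suc a)))
    (subst (+ b′ * + suc a ℤ.≤_) (sym (ℤₚ.pos-* b (suc a′))) le)))

-- First-cycle games

module Games {k k' m} (N : OCN k m) (N' : OCN k' m)
  (L : ℕ) (maximal : ∀ L' → AcyclicPathOfLength N N' L' → L' ≤ L) where

  State : Set
  State = Node k k'

  _≟ˢ_ : (v w : State) → Dec (v ≡ w)
  _≟ˢ_ = ≡-dec Fin._≟_ Fin._≟_

  C : ℕ
  C = suc L

  -- Histories grow at the head, so the newest node comes first and edges point backwards along the
  -- list.
  Trail : List State → Set
  Trail = Linked (λ w v → Edge N N' v w)

  reverse-path : ∀ {v us} vs → Trail (v ∷ vs) → IsPath N N' (v ∷ us) → IsPath N N' (vs ʳ++ (v ∷ us))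
  reverse-path [] _ path = path
  reverse-path (w ∷ vs) (edge ∷ trail) path = reverse-path vs trail (cons edge path)

  -- Reversed, a nonempty trail is an acyclic path with one edge fewer than nodes. Maximality of `L`
  -- enters the proof here.
  trail-length : ∀ vs → Trail vs → Unique vs → length vs ≤ C
  trail-length [] _ _ = z≤n
  trail-length (v ∷ vs) trail unique = s≤s (maximal (length vs)
    ( reverse (v ∷ vs) , reverse-path vs trail (single v)
    , PermutationSetoid.Unique-resp-↭ (setoid State) (↭⇒↭ₛ (↭-sym (↭-reverse (v ∷ vs)))) unique
    , Listₚ.length-reverse (v ∷ vs)))

  target : Trans k m → Trans k' m → State
  target t t' = tgt t , tgt t'

  effect : Trans k m → Trans k' m → Vec²
  effect t t' = ⟦ eff t ⟧ , ⟦ eff t' ⟧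

  effect-small : ∀ t t' → Small 1 (effect t t')
  effect-small t t' = ∣⟦ eff t ⟧∣≤1 , ∣⟦ eff t' ⟧∣≤1

  Entry : Set
  Entry = State × Vec²

  module FirstCycle (σ : Slope) (A : State → Set) where

    -- Spoiler wins the first-cycle game within n rounds; leaving A is a win for Duplicator.
    mutual
      Forced : ℕ → Entry → List Entry → Set
      Forced zero _ _ = ⊥
      Forced (suc n) e@((p , p') , x) h =
        Any (λ t → src t ≡ p ×
               All (λ t' → src t' ≡ p' → label t ≡ label t' →
                      Reply n (e ∷ h) (target t t') (x ⊕ effect t t'))
                   (δ N'))
            (δ N)

      Reply : ℕ → List Entry → State → Vec² → Set
      Reply n h w y =
        A w ×
        -- At a repeated node the difference of cumulative effects is the effect of the cycle just
        -- closed. This component is vacuous for a new node, the next one for a repeated node.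
        All (λ e → proj₁ e ≡ w → cross σ (y ⊖ proj₂ e) ℤ.< 0ℤ) h ×
        (All (λ e → proj₁ e ≢ w) h → Forced n (w , y) h)

    module _ (A? : Decidable A) where
      mutual
        forced? : ∀ n e h → Dec (Forced n e h)
        forced? zero _ _ = no λ ()
        forced? (suc n) e@((p , p') , x) h =
          any? (λ t → (src t Fin.≟ p) ×-dec
                  all? (λ t' → (src t' Fin.≟ p') →-dec ((label t Fin.≟ label t') →-dec
                          reply? n (e ∷ h) (target t t') (x ⊕ effect t t')))
                       (δ N'))
               (δ N)

        reply? : ∀ n h w y → Dec (Reply n h w y)
        reply? n h w y =
          A? w ×-dec
          (all? (λ e → (proj₁ e ≟ˢ w) →-dec (cross σ (y ⊖ proj₂ e) ℤₚ.<? 0ℤ)) h ×-dec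
           (all? (λ e → ¬? (proj₁ e ≟ˢ w)) h →-dec forced? n (w , y) h))

    -- (w , x) is the current node with the cumulative effect since o; the fuel n counts
    -- down from C, and P holds along every prefix of the path.
    data History (P : ℕ → Entry → List Entry → Set) (o : State) : ℕ → Entry → List Entry → Set where
      start : A o → P C (o , 0v) [] → History P o C (o , 0v) []
      push  : ∀ {n w y e h} → A w → P n (w , y) (e ∷ h) → Edge N N' (proj₁ e) w →
              Small 1 (y ⊖ proj₂ e) → All (λ f → proj₁ f ≢ w) (e ∷ h) →
              History P o (suc n) e h → History P o n (w , y) (e ∷ h)

    module _ {P : ℕ → Entry → List Entry → Set} {o : State} where

      current : ∀ {n e h} → History P o n e h → P n e h
      current (start _ p) = p
      current (push _ p _ _ _ _) = p

      current-A : ∀ {n e h} → History P o n e h → A (proj₁ e)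
      current-A (start a _) = a
      current-A (push a _ _ _ _ _) = a

      fuel : ∀ {n e h} → History P o n e h → n ℕ.+ length h ≡ C
      fuel (start _ _) = ℕₚ.+-identityʳ C
      fuel (push {n} {h = h} _ _ _ _ _ hist) = trans (ℕₚ.+-suc n (length h)) (fuel hist)

      -- Forgets a closed cycle: play resumes at the earlier visit, where `P` was recorded together
      -- with the fuel of that moment.
      rewind : ∀ {n e h f} → History P o n e h → f ∈ e ∷ h → ∃[ n' ] ∃[ h' ] History P o n' f h'
      rewind hist (here refl) = _ , _ , hist
      rewind (push _ _ _ _ _ hist) (there f∈) = rewind hist f∈

      all-A : ∀ {n e h} → History P o n e h → All A (map proj₁ (e ∷ h))
      all-A (start a _) = a ∷ []
      all-A (push a _ _ _ _ hist) = a ∷ all-A hist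

      -- The tail `vs` makes room for a path played in earlier phases that leads to the origin `o`.
      trail : ∀ {n e h vs} → Trail (o ∷ vs) → History P o n e h → Trail (map proj₁ (e ∷ h) ++ vs)
      trail older (start _ _) = older
      trail older (push _ _ edge _ _ hist) = edge ∷ trail older hist

      unique : ∀ {n e h} → History P o n e h → Unique (map proj₁ (e ∷ h))
      unique (start _ _) = [] ∷ []
      unique (push _ _ _ _ fresh hist) = All-map⁺ (All.map (_∘ sym) fresh) ∷ unique hist

      depth : ∀ {n e h} → History P o n e h → suc (length h) ≤ C
      depth {n} {e} {h} hist = subst (_≤ C)
        (trans (cong length (Listₚ.++-identityʳ (map proj₁ (e ∷ h)))) (Listₚ.length-map proj₁ (e ∷ h)))
        (trail-length _ (trail [-] hist) (subst Unique (sym (Listₚ.++-identityʳ (map proj₁ (e ∷ h)))) (unique hist)))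

      offset : ∀ {n v x h} → History P o n (v , x) h → Small (length h) x
      offset (start _ _) = z≤n , z≤n
      offset (push {y = y} {e = _ , x} {h = h} _ _ _ near _ hist) =
        subst (Small (suc (length h))) (p⊖q⊕q≡p y x) (Small-⊕ (y ⊖ x) x near (offset hist))

      offset-from : ∀ {n v x h} → History P o n (v , x) h →
                    All (λ f → Small (length h) (x ⊖ proj₂ f)) ((v , x) ∷ h)
      offset-from (start _ _) = (z≤n , z≤n) ∷ []
      offset-from (push {y = y} {e = e} {h = h} _ _ _ near _ hist) =
        subst (Small (suc (length h))) (sym (p⊖p≡0 y)) (z≤n , z≤n) ∷
        All.map (λ {f} s → subst (Small (suc (length h))) (p⊖q⊕q⊖r≡p⊖r y (proj₂ e) (proj₂ f))
                  (Small-⊕ (y ⊖ proj₂ e) (proj₂ e ⊖ proj₂ f) near s))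
                (offset-from hist)

    -- R is an invariant Duplicator can maintain; Ok tells which values of Spoiler's counter are legal.
    Closed : (ℤ → Set) → (State → Vec² → Set) → Set
    Closed Ok R = ∀ {v p} → R v p → ∀ {t} → t ∈ δ N → src t ≡ proj₁ v → Ok (proj₁ p + ⟦ eff t ⟧) →
      ∃[ t' ] t' ∈ δ N' × src t' ≡ proj₂ v × label t ≡ label t' ×
              (A (target t t') → R (target t t') (p ⊕ effect t t'))

    -- Spoiler repeats the first-cycle game

    module Spoiler {Ok : ℤ → Set} {R : State → Vec² → Set} (closed : Closed Ok R) where

      Playable : Vec² → Set
      Playable base = ∀ {z} → ∣ z ∣ ≤ C → Ok (proj₁ base + z)

      -- The position reached is base ⊕ offset: base collects the closed cycles.
      record Reached (base : Vec²) : Set where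
        constructor reached
        field
          {origin node} : State
          {remaining}   : ℕ
          {offset-vec}  : Vec²
          {visited}     : List Entry
          history       : History Forced origin remaining (node , offset-vec) visited
          related       : R node (base ⊕ offset-vec)

      -- Recursion on the fuel: Spoiler follows `Forced` and `closed` supplies the replies. A new
      -- node extends the history; at a repeated one the history is rewound and the effect of the
      -- cycle moves into the base.
      cycle : ∀ {o n v x h} base → Playable base → History Forced o n (v , x) h → R v (base ⊕ x) →
              ∃[ α ] Small C α × cross σ α ℤ.< 0ℤ × Reached (base ⊕ α)
      cycle {n = zero} base play hist r = ⊥-elim (current hist)
      cycle {n = suc n} {v} {x} {h} base play hist r with find (current hist)
      ... | t , t∈ , src≡ , replies
          with closed r t∈ src≡
                 -- After this move the offset comes from at most `length h + 1` edges, which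
                 -- `depth` bounds by `C`.
                 (subst Ok (sym (ℤₚ.+-assoc (proj₁ base) (proj₁ x) ⟦ eff t ⟧))
                   (play (ℕₚ.≤-trans (ℤₚ.∣i+j∣≤∣i∣+∣j∣ (proj₁ x) ⟦ eff t ⟧)
                     (ℕₚ.≤-trans (ℕₚ.+-mono-≤ (proj₁ (offset hist)) ∣⟦ eff t ⟧∣≤1)
                       (subst (_≤ C) (ℕₚ.+-comm 1 (length h)) (depth hist))))))
      ... | t' , t'∈ , src'≡ , label≡ , next with lookup replies t'∈ src'≡ label≡
      ... | inA , bad , extend with any? (λ e → proj₁ e ≟ˢ target t t') ((v , x) ∷ h)
      ... | no new = cycle base play
              (push inA (extend fresh) (t , t' , t∈ , t'∈ , label≡ , src≡ , src'≡ , refl , refl)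
                (subst (Small 1) (sym (p⊕d⊖p≡d x (effect t t'))) (effect-small t t')) fresh hist)
              (subst (R _) (⊕-assoc base x (effect t t')) (next inA))
        where fresh = ¬Any⇒All¬ _ new
      ... | yes old with find old
      ... | (w , y) , f∈ , refl =
              x ⊕ effect t t' ⊖ y ,
              subst (Small C) (sym (p⊕d⊖q≡[p⊖q]⊕d x (effect t t') y))
                (Small-mono (x ⊖ y ⊕ effect t t') (subst (_≤ C) (ℕₚ.+-comm 1 (length h)) (depth hist))
                  (Small-⊕ (x ⊖ y) (effect t t') (lookup (offset-from hist) f∈) (effect-small t t'))) ,
              lookup bad f∈ refl ,
              reached (proj₂ (proj₂ (rewind hist f∈)))
                (subst (R _)
                  (trans (⊕-assoc base x (effect t t'))
                    (trans (cong (base ⊕_) (sym (p⊖q⊕q≡p (x ⊕ effect t t') y)))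
                      (sym (⊕-assoc base (x ⊕ effect t t' ⊖ y) y))))
                  (next inA))

      module _ (Inv : Vec² → Set)
               (playable : ∀ {base v x} → Inv base → Small C x → R v (base ⊕ x) → Playable base)
               (preserved : ∀ {base α} → Inv base → Small C α → cross σ α ℤ.< 0ℤ → Inv (base ⊕ α)) where

        -- `cross` takes integer values, so each losing cycle lowers it by at least one.
        cycles : ∀ J {base} → Inv base → Reached base →
                 ∃[ base' ] cross σ base' + + J ℤ.≤ cross σ base × Reached base'
        cycles zero {base} inv r = base , ℤₚ.≤-reflexive (ℤₚ.+-identityʳ _) , r
        cycles (suc J) {base} inv (reached {offset-vec = x} hist r)
          with cycle base (playable inv (Small-mono x (ℕₚ.≤-trans (ℕₚ.n≤1+n _) (depth hist)) (offset hist)) r) hist r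
        ... | α , small , bad , next with cycles J (preserved inv small bad) next
        ... | base' , le , r' =
              base' ,
              ≤-by (eq (cross σ base) (cross σ α) (cross σ base') (+ J))
                (0≤-+ (subst (λ c → 0ℤ ℤ.≤ c - (cross σ base' + + J)) (cross-⊕ σ base α) (ℤₚ.i≤j⇒0≤j-i le))
                      (<⇒0≤ bad)) ,
              r'
          where
          eq : ∀ b a b' J → b - (b' + (1ℤ + J)) ≡ (b + a - (b' + J)) + (0ℤ - a - 1ℤ)
          eq = solve-∀

        drive : ∀ K {v p} → A v → Forced C (v , 0v) [] → R v p → Inv p →
                ∃[ v' ] ∃[ p' ] A v' × R v' p' × cross σ p' ℤ.< - + K
        drive K {v} {p} a forced r inv
          -- The summands make up for the initial value, the target `K` and the final offset; the
          -- last 1 gives strictness.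
          with cycles (∣ cross σ p ∣ ℕ.+ K ℕ.+ C ℕ.* weight σ ℕ.+ 1) inv
                 (reached (start a forced) (subst (R v) (sym (⊕-identityʳ p)) r))
        ... | base' , le , reached {node = v'} {offset-vec = x} hist r' =
              v' , base' ⊕ x , current-A hist , r' ,
              subst (ℤ._< - + K) (sym (cross-⊕ σ base' x))
                (<-by (eq (cross σ base') (cross σ x) (cross σ p) (+ ∣ cross σ p ∣) (+ K) (+ (C ℕ.* weight σ)))
                  (0≤-+ (0≤-+ (ℤₚ.i≤j⇒0≤j-i le) (∣i∣≤k⇒0≤k-i (cross σ p) ℕₚ.≤-refl))
                        (∣i∣≤k⇒0≤k-i (cross σ x)
                          (∣cross∣≤ σ x (Small-mono x (ℕₚ.≤-trans (ℕₚ.n≤1+n _) (depth hist)) (offset hist))))))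
          where
          eq : ∀ b x c a K W → - K - (b + x) - 1ℤ ≡ (c - (b + (a + K + W + 1ℤ))) + (a - c) + (W - x)
          eq = solve-∀

    ¬Forced : ℕ → Entry → List Entry → Set
    ¬Forced n e h = ¬ Forced n e h

    -- Duplicator avoids losing cycles

    module Duplicator (A? : Decidable A) where

      -- Determinacy of a finite decidable game: as Spoiler cannot force a win, some answer to `t`
      -- fails `Reply`, and the component that fails tells which outcome occurs.
      respond : ∀ {o n v x h t} → History ¬Forced o n (v , x) h → t ∈ δ N → src t ≡ proj₁ v →
                ∃[ t' ] t' ∈ δ N' × src t' ≡ proj₂ v × label t ≡ label t' ×
                  (¬ A (target t t') ⊎
                   ∃[ α ] ∃[ n' ] ∃[ x' ] ∃[ h' ] History ¬Forced o n' (target t t' , x') h' ×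
                     x ⊕ effect t t' ≡ α ⊕ x' × 0ℤ ℤ.≤ cross σ α)
      -- Without fuel the history would have `C + 1` distinct nodes.
      respond {n = zero} hist _ _ = ⊥-elim (ℕₚ.<-irrefl (fuel hist) (depth hist))
      respond {n = suc n} {v} {x} {h} {t} hist t∈ src≡
        with find (¬All⇒Any¬
               (λ t' → (src t' Fin.≟ proj₂ v) →-dec ((label t Fin.≟ label t') →-dec
                          reply? A? n ((v , x) ∷ h) (target t t') (x ⊕ effect t t')))
               (δ N') (λ replies → current hist (lose t∈ (src≡ , replies))))
      ... | t' , t'∈ , ¬reply
        with src t' Fin.≟ proj₂ v | label t Fin.≟ label t'
      ... | no src'≢ | _ = ⊥-elim (¬reply λ src'≡ → ⊥-elim (src'≢ src'≡))
      ... | yes _ | no label≢ = ⊥-elim (¬reply λ _ label≡ → ⊥-elim (label≢ label≡))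
      ... | yes src'≡ | yes label≡ = t' , t'∈ , src'≡ , label≡ , outcome
        where
        w = target t t'
        d = effect t t'

        outcome : ¬ A w ⊎ ∃[ α ] ∃[ n' ] ∃[ x' ] ∃[ h' ]
                    History ¬Forced _ n' (w , x') h' × x ⊕ d ≡ α ⊕ x' × 0ℤ ℤ.≤ cross σ α
        outcome with A? w
        ... | no ¬a = inj₁ ¬a
        ... | yes a with any? (λ e → proj₁ e ≟ˢ w) ((v , x) ∷ h)
        ... | no new =
              inj₂ (0v , n , x ⊕ d , (v , x) ∷ h ,
                push a (λ forced → ¬reply λ _ _ → a , All.map (λ ≢w ≡w → ⊥-elim (≢w ≡w)) fresh , λ _ → forced)
                  (t , t' , t∈ , t'∈ , label≡ , src≡ , src'≡ , refl , refl)
                  (subst (Small 1) (sym (p⊕d⊖p≡d x d)) (effect-small t t')) fresh hist ,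
                sym (⊕-identityˡ (x ⊕ d)) ,
                ℤₚ.≤-reflexive (sym (cross-0v σ)))
          where fresh = ¬Any⇒All¬ _ new
        ... | yes old
          -- At a repeated node only the condition on cycles can fail, which yields a cycle not
          -- strictly below `σ`.
          with find (¬All⇒Any¬ (λ e → (proj₁ e ≟ˢ w) →-dec (cross σ (x ⊕ d ⊖ proj₂ e) ℤₚ.<? 0ℤ)) ((v , x) ∷ h)
                 (λ bad → ¬reply λ _ _ → a , bad , λ fresh → ⊥-elim (All¬⇒¬Any fresh old)))
        ... | (u , y) , f∈ , ¬bad with u ≟ˢ w
        ... | no u≢w = ⊥-elim (¬bad λ u≡w → ⊥-elim (u≢w u≡w))
        ... | yes refl with rewind hist f∈
        ... | n' , h' , hist' =
              inj₂ (x ⊕ d ⊖ y , n' , y , h' , hist' , sym (p⊖q⊕q≡p (x ⊕ d) y) ,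
                    ℤₚ.≮⇒≥ (λ lt → ¬bad λ _ → lt))

      -- Positions that Duplicator's strategy can reach, with the closed cycles absorbed in a base
      -- whose `cross` never drops below `c`.
      Held : ℤ → State → Vec² → Set
      Held c v p = ∃[ base ] ∃[ o ] ∃[ n ] ∃[ x ] ∃[ h ]
        History ¬Forced o n (v , x) h × p ≡ base ⊕ x × c ℤ.≤ cross σ base

      held-closed : ∀ c → Closed (λ _ → ⊤) (Held c)
      held-closed c (base , o , n , x , h , hist , refl , le) {t} t∈ src≡ _ with respond hist t∈ src≡
      ... | t' , t'∈ , src'≡ , label≡ , inj₁ ¬a = t' , t'∈ , src'≡ , label≡ , λ a → ⊥-elim (¬a a)
      ... | t' , t'∈ , src'≡ , label≡ , inj₂ (α , n' , x' , h' , hist' , eq , nonneg) =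
            t' , t'∈ , src'≡ , label≡ , λ _ →
              base ⊕ α , o , n' , x' , h' , hist' ,
              trans (⊕-assoc base x (effect t t')) (trans (cong (base ⊕_) eq) (sym (⊕-assoc base α x'))) ,
              subst (c ℤ.≤_) (sym (cross-⊕ σ base α))
                (subst (ℤ._≤ cross σ base + cross σ α) (ℤₚ.+-identityʳ c) (ℤₚ.+-mono-≤ le nonneg))

      -- Played against each other from v, Duplicator's history strategy and a fresh
      -- strategy of Spoiler would keep cross σ both bounded and unbounded from below.
      ¬forced-current : ∀ {o n v x h} → History ¬Forced o n (v , x) h → ¬ Forced C (v , 0v) []
      ¬forced-current {o} {n} {v} {x} {h} hist forced = bounded
        (Spoiler.drive (held-closed 0ℤ) (λ _ → ⊤) (λ _ _ _ _ → tt) (λ _ _ _ → tt)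
           (C ℕ.* weight σ) (current-A hist) forced
           (0v , o , n , x , h , hist , refl , ℤₚ.≤-reflexive (sym (cross-0v σ))) tt)
        where
        eq : ∀ b x W → b + x - (- W) ≡ b + (W + x)
        eq = solve-∀

        bounded : ¬ (∃[ v' ] ∃[ p' ] A v' × Held 0ℤ v' p' × cross σ p' ℤ.< - + (C ℕ.* weight σ))
        bounded (v' , p' , _ , (base , _ , _ , x' , _ , hist' , refl , le) , lt) =
          ℤₚ.<⇒≱ (subst (ℤ._< - + (C ℕ.* weight σ)) (cross-⊕ σ base x') lt)
            (≤-by (eq (cross σ base) (cross σ x') (+ (C ℕ.* weight σ)))
              (0≤-+ le
                (∣i∣≤k⇒0≤k+i (cross σ x')
                  (∣cross∣≤ σ x' (Small-mono x' (ℕₚ.≤-trans (ℕₚ.n≤1+n _) (depth hist')) (offset hist'))))))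

  -- Regions along a chain of slopes

  Region : List Slope → State → Set
  Region [] v = ⊤
  Region (σ ∷ σs) v = Region σs v × FirstCycle.Forced σ (Region σs) C (v , 0v) []

  region? : ∀ σs → Decidable (Region σs)
  region? [] v = yes tt
  region? (σ ∷ σs) v = region? σs v ×-dec FirstCycle.forced? σ (Region σs) (region? σs) C (v , 0v) []

  Admissible : Slope → Set
  Admissible (a , b) = Positive a b × a ≤ C × b ≤ C

  -- A descending list of slopes such that no cycle effect separates two neighbours.
  data Chain : Slope → List Slope → Set where
    flat  : ∀ {a} → Admissible (a , 0) → Chain (a , 0) []
    steep : ∀ {ρ u us} → Admissible ρ → u ≼ ρ →
            (∀ {α} → Small C α → cross u α ℤ.< 0ℤ → cross ρ α ℤ.≤ 0ℤ) →
            Chain u us → Chain ρ (u ∷ us)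

  admissible : ∀ {ρ us} → Chain ρ us → Admissible ρ
  admissible (flat ok) = ok
  admissible (steep ok _ _ _) = ok

  -- Spoiler wins below the line

  module _ (R : Conf k → Conf k' → Set) (sim : IsSimulation N N' R) where

    Related : State → Vec² → Set
    Related (p , p') z = ∃[ n ] ∃[ n' ] z ≡ (+ n , + n') × R (p , n) (p' , n')

    related-closed : ∀ u us → FirstCycle.Closed u (Region us) (0ℤ ℤ.≤_) Related
    related-closed u us {p , p'} (n , n' , refl , r) {t} t∈ src≡ ok with +⇒Apply (eff t) n ok
    ... | n₁ , applied with sim (p , n) (p' , n') r (label t) (tgt t , n₁) (t , t∈ , src≡ , refl , refl , applied)
    ... | (q' , n₁') , (t' , t'∈ , src'≡ , label≡ , refl , applied') , r' =
          t' , t'∈ , src'≡ , sym label≡ , λ _ →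
            n₁ , n₁' , cong₂ _,_ (sym (Apply⇒+ (eff t) applied)) (sym (Apply⇒+ (eff t') applied')) , r'

    -- Induction along the chain, with `R` answering for Duplicator: driving `cross u` down leads to
    -- a related position that is `C`-below `u` and lies in the region belonging to `u`. Nothing is
    -- below a horizontal line, since Duplicator's counter is nonnegative.
    below-wins : ∀ {ρ us v z} → Chain ρ us → Region us v → BelowLine C ρ z → ¬ Related v z
    below-wins (flat {a} _) _ below (n , n' , refl , _) =
      ℤₚ.<⇒≱ below (≤-by (eq (+ a) (+ n) (+ n') (+ (C ℕ.* weight (a , 0))))
        (0≤-+ (0≤-* (0≤+ a) (0≤+ n')) (0≤+ _)))
      where
      eq : ∀ a n n' W → (a * n' - 0ℤ * n) - (- W) ≡ a * n' + W
      eq = solve-∀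
    below-wins {ρ} {u ∷ us} {v} {z} (steep _ _ gap chain) (region , forced) below r =
      flatter (FirstCycle.Spoiler.drive u (Region us) {Ok = 0ℤ ℤ.≤_} (related-closed u us)
        (BelowLine C ρ) playable preserved (C ℕ.* weight u) region forced r below)
      where
      eq : ∀ x c z → x + z ≡ (x - c) + (c + z)
      eq = solve-∀
      eq′ : ∀ y x c → y + c ≡ (y + x) + (c - x)
      eq′ = solve-∀

      -- Duplicator's actual counter is nonnegative, so at the base it is at least `- C`. Being
      -- below `ρ` then puts Spoiler's counter at the base above `C`.
      playable : ∀ {base w x} → BelowLine C ρ base → Small C x → Related w (base ⊕ x) →
                 ∀ {i} → ∣ i ∣ ≤ C → 0ℤ ℤ.≤ proj₁ base + i
      playable {base} {w} {x} below (_ , small) (_ , n' , pos , _) {i} i≤C =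
        subst (0ℤ ℤ.≤_) (sym (eq (proj₁ base) (+ C) i))
          (0≤-+ (ℤₚ.<⇒≤ (BelowLine⇒c<x ρ base below
                  (subst (0ℤ ℤ.≤_) (sym (eq′ (proj₂ base) (proj₂ x) (+ C)))
                    (0≤-+ (subst (0ℤ ℤ.≤_) (sym (cong proj₂ pos)) (0≤+ n'))
                          (∣i∣≤k⇒0≤k-i (proj₂ x) small)))))
                (∣i∣≤k⇒0≤k+i i i≤C))

      preserved : ∀ {base α} → BelowLine C ρ base → Small C α → cross u α ℤ.< 0ℤ → BelowLine C ρ (base ⊕ α)
      preserved {base} {α} below small neg =
        subst (ℤ._< - + (C ℕ.* weight ρ)) (sym (cross-⊕ ρ base α))
          (subst (cross ρ base + cross ρ α ℤ.<_) (ℤₚ.+-identityʳ _) (ℤₚ.+-mono-<-≤ below (gap small neg)))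

      flatter : ¬ (∃[ v' ] ∃[ z' ] Region us v' × Related v' z' × BelowLine C u z')
      flatter (_ , _ , region' , r' , below') = below-wins chain region' below' r'

  -- Duplicator wins above the line

  module _ {σ : Slope} {σs : List Slope} where
    open FirstCycle σ (Region σs)
    open Duplicator (region? σs)

    -- Gives the disjointness of phases: nodes frozen earlier lie in `Region (σ ∷ σs)`, those of the
    -- current phase do not.
    leaves-region : ∀ {o n e h} → History ¬Forced o n e h → All (λ v → ¬ Region (σ ∷ σs) v) (map proj₁ (e ∷ h))
    leaves-region hist@(start _ _) = (¬forced-current hist ∘ proj₂) ∷ []
    leaves-region hist@(push _ _ _ _ _ hist') = (¬forced-current hist ∘ proj₂) ∷ leaves-region hist'

  -- The frozen path old was played for steeper slopes; it avoids the nodes of the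
  -- current phase, so that old and the current history form one acyclic path.
  record Safe (c : Conf k) (c' : Conf k') : Set where
    field
      {ρ}          : Slope
      {us}         : List Slope
      {o}          : State
      {fuel-left}  : ℕ
      {x}          : Vec²
      {h}          : List Entry
      chain        : Chain ρ us
      history      : FirstCycle.History ρ (Region us) (FirstCycle.¬Forced ρ (Region us))
                       o fuel-left ((proj₁ c , proj₁ c') , x) h
      old          : List State
      old-trail    : Trail (o ∷ old)
      old-unique   : Unique old
      old-region   : All (Region (ρ ∷ us)) old
      base         : Vec²
      shift        : Vec²
      shift-small  : Small (length old) shift
      above        : AboveLine C ρ base
      position     : (+ proj₂ c , + proj₂ c') ≡ base ⊕ (shift ⊕ x)

  -- What a new phase at `w` needs. The field `inside` places all nodes played so far in the region
  -- that the new phase avoids.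
  record Descent (us : List Slope) (w : State) (base : Vec²) : Set where
    constructor descent
    field
      {ρ'}    : Slope
      {us'}   : List Slope
      chain'  : Chain ρ' us'
      region  : Region us' w
      unforced : ¬ FirstCycle.Forced ρ' (Region us') C (w , 0v) []
      above'  : AboveLine C ρ' base
      inside  : ∀ {v} → Region us v → Region (ρ' ∷ us') v

  -- Walks down to the first slope whose own region omits `w` while the region of the rest of the
  -- chain contains it. The walk stops because the empty chain has every node in its region.
  descend : ∀ {ρ us w base} → Chain ρ us → ¬ Region us w → 0ℤ ℤ.≤ proj₁ base + + C →
            AboveLine C ρ base → Descent us w base
  descend (flat _) ¬region _ _ = ⊥-elim (¬region tt)
  descend {ρ} {u ∷ us} {w} {base} (steep _ u≼ρ _ chain) ¬region 0≤x+C above with region? us w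
  ... | yes region = descent chain region (λ forced → ¬region (region , forced))
                       (AboveLine-≼ u ρ base (proj₁ (admissible chain)) u≼ρ 0≤x+C above) (λ r → r)
  ... | no ¬region' with descend chain ¬region' 0≤x+C
                           (AboveLine-≼ u ρ base (proj₁ (admissible chain)) u≼ρ 0≤x+C above)
  ... | descent chain' region unforced above' inside = descent chain' region unforced above' (λ r → inside (proj₁ r))

  module _ {p : Fin k} {n : ℕ} {p' : Fin k'} {n' : ℕ} (safe : Safe (p , n) (p' , n')) where
    open Safe safe
    open FirstCycle ρ (Region us)

    path : List State
    path = map proj₁ (((p , p') , x) ∷ h) ++ old

    path-unique : Unique path
    path-unique = Unique-++⁺ (unique history) old-unique
      (λ (v∈new , v∈old) → lookup (leaves-region history) v∈new (lookup old-region v∈old))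

    path-trail : Trail path
    path-trail = trail old-trail history

    length-path : length path ≡ suc (length h) ℕ.+ length old
    length-path = trans (Listₚ.length-++ (map proj₁ (((p , p') , x) ∷ h)))
                        (cong (ℕ._+ length old) (Listₚ.length-map proj₁ (((p , p') , x) ∷ h)))

    -- The path has one node more than edges, so counting nodes already pays for the coming move.
    next-small : ∀ t t' → Small (length path) (shift ⊕ x ⊕ effect t t')
    next-small t t' = subst (λ l → Small l (shift ⊕ x ⊕ effect t t')) (trans count (sym length-path))
      (Small-⊕ (shift ⊕ x) (effect t t')
        (Small-⊕ shift x shift-small (offset history)) (effect-small t t'))
      where
      count : length old ℕ.+ length h ℕ.+ 1 ≡ suc (length h) ℕ.+ length old
      count = trans (ℕₚ.+-comm (length old ℕ.+ length h) 1) (cong suc (ℕₚ.+-comm (length old) (length h)))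

    path-length : length path ≤ C
    path-length = trail-length path path-trail path-unique

    -- Spoiler's actual counter is nonnegative and differs from the base by at most `C`. Passing to
    -- a flatter slope requires this bound.
    base-bound : 0ℤ ℤ.≤ proj₁ base + + C
    base-bound = subst (0ℤ ℤ.≤_) (sym (eq (proj₁ base) (proj₁ (shift ⊕ x)) (+ C)))
      (0≤-+ (subst (0ℤ ℤ.≤_) (cong proj₁ position) (0≤+ n))
            (∣i∣≤k⇒0≤k-i (proj₁ (shift ⊕ x))
              (proj₁ (Small-mono (shift ⊕ x)
                (ℕₚ.≤-trans (subst (length old ℕ.+ length h ≤_) (sym length-path) count) path-length)
                (Small-⊕ shift x shift-small (offset history))))))
      where
      eq : ∀ b s c → b + c ≡ (b + s) + (c - s)
      eq = solve-∀
      count : length old ℕ.+ length h ≤ suc (length h) ℕ.+ length old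
      count = ℕₚ.≤-trans (ℕₚ.≤-reflexive (ℕₚ.+-comm (length old) (length h))) (ℕₚ.n≤1+n _)

    next-position : ∀ t t' → (+ n + ⟦ eff t ⟧ , + n' + ⟦ eff t' ⟧) ≡ base ⊕ (shift ⊕ x ⊕ effect t t')
    next-position t t' = trans (cong (_⊕ effect t t') position) (⊕-assoc base (shift ⊕ x) (effect t t'))

    safe-step : ∀ {t n₁} → t ∈ δ N → src t ≡ p → Apply (eff t) n n₁ →
                ∃[ t' ] ∃[ n₁' ] t' ∈ δ N' × src t' ≡ p' × label t ≡ label t' ×
                  Apply (eff t') n' n₁' × Safe (tgt t , n₁) (tgt t' , n₁')
    safe-step {t} {n₁} t∈ src≡ applied with Duplicator.respond (region? us) history t∈ src≡
    ... | t' , t'∈ , src'≡ , label≡ , outcome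
      -- Even after the move the offset from the base is at most `C`, so the margin keeps
      -- Duplicator's counter nonnegative.
      with +⇒Apply (eff t') n' (subst (0ℤ ℤ.≤_) (sym (cong proj₂ (next-position t t')))
             (AboveLine⇒0≤y ρ base (shift ⊕ x ⊕ effect t t') above
               (Small-mono (shift ⊕ x ⊕ effect t t') path-length (next-small t t'))
               (subst (0ℤ ℤ.≤_) (trans (Apply⇒+ (eff t) applied) (cong proj₁ (next-position t t'))) (0≤+ n₁))))
    ... | n₁' , applied' = t' , n₁' , t'∈ , src'≡ , label≡ , applied' , continue outcome
      where
      d : Vec²
      d = effect t t'

      arrived : (+ n₁ , + n₁') ≡ base ⊕ (shift ⊕ x ⊕ d)
      arrived = trans (cong₂ _,_ (Apply⇒+ (eff t) applied) (Apply⇒+ (eff t') applied')) (next-position t t')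

      continue : ¬ Region us (target t t') ⊎
                 (∃[ α ] ∃[ n' ] ∃[ x' ] ∃[ h' ] History ¬Forced o n' (target t t' , x') h' ×
                    x ⊕ d ≡ α ⊕ x' × 0ℤ ℤ.≤ cross ρ α) →
                 Safe (tgt t , n₁) (tgt t' , n₁')
      -- The whole path is frozen and its effect, this move included, becomes the shift; the base
      -- stays put.
      continue (inj₁ ¬region) with descend chain ¬region base-bound above
      ... | descent chain' region unforced above' inside = record
        { chain = chain' ; history = FirstCycle.start region unforced
        ; old = path
        ; old-trail = (t , t' , t∈ , t'∈ , label≡ , src≡ , src'≡ , refl , refl) ∷ path-trail
        ; old-unique = path-unique
        ; old-region = All-++⁺ (All.map inside (all-A history)) (All.map (inside ∘ proj₁) old-region)
        ; base = base ; shift = shift ⊕ x ⊕ d ; shift-small = next-small t t' ; above = above'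
        ; position = trans arrived (cong (base ⊕_) (sym (⊕-identityʳ (shift ⊕ x ⊕ d))))
        }
      -- The phase goes on: a closed cycle has `cross ρ α ≥ 0`, so the base can absorb it and remain
      -- above `ρ`.
      continue (inj₂ (α , _ , x' , _ , history' , eq , nonneg)) = record
        { chain = chain ; history = history'
        ; old = old ; old-trail = old-trail ; old-unique = old-unique ; old-region = old-region
        ; base = base ⊕ α ; shift = shift ; shift-small = shift-small
        ; above = subst (+ (C ℕ.* weight ρ) ℤ.<_) (sym (cross-⊕ ρ base α))
            (subst (ℤ._< cross ρ base + cross ρ α) (ℤₚ.+-identityʳ _) (ℤₚ.+-mono-<-≤ above nonneg))
        ; position = trans arrived (trans (cong (base ⊕_) (trans (⊕-assoc shift x d) (cong (shift ⊕_) eq)))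
                                          (⊕-regroup base shift α x'))
        }

  safe-simulation : IsSimulation N N' Safe
  safe-simulation (p , n) (p' , n') safe a (q , n₁) (t , t∈ , src≡ , refl , refl , applied)
    with safe-step safe t∈ src≡ applied
  ... | t' , n₁' , t'∈ , src'≡ , label≡ , applied' , safe' =
        (tgt t' , n₁') , (t' , t'∈ , src'≡ , sym label≡ , refl , applied') , safe'

  above-wins : ∀ {ρ us p p' n n'} → Chain ρ us → Region us (p , p') → ¬ Region (ρ ∷ us) (p , p') →
               AboveLine C ρ (+ n , + n') → Simulated N N' (p , n) (p' , n')
  above-wins {n = n} {n'} chain region ¬region above = Safe , safe-simulation , record
    { chain = chain ; history = FirstCycle.start region (λ forced → ¬region (region , forced))
    ; old = [] ; old-trail = [-] ; old-unique = [] ; old-region = []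
    ; base = + n , + n' ; shift = 0v ; shift-small = z≤n , z≤n ; above = above
    ; position = sym (⊕-identityʳ (+ n , + n'))
    }

  -- Choosing the slope of a node

  Belt : State → Slope → Set₁
  Belt (q , q') (ρ , ρ') =
    (∀ n n' → Above C ρ ρ' n n' → Simulated N N' (q , n) (q' , n')) ×
    (∀ n n' → Below C ρ ρ' n n' → ¬ Simulated N N' (q , n) (q' , n'))

  -- Descends until `v` lies in `Region us`. The argument `wins` carries the half above the line:
  -- each step down is taken because `v` misses a region, which is just what `above-wins` needs for
  -- the next slope.
  find-slope : ∀ {ρ us v} → Chain ρ us →
               (Region us v → ∀ n n' → Above C (proj₁ ρ) (proj₂ ρ) n n' → Simulated N N' (proj₁ v , n) (proj₂ v , n')) →
               ∃[ τ ] Admissible τ × Belt v τ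
  find-slope {ρ} {us} {v} chain wins with region? us v
  ... | yes region = ρ , admissible chain , wins region ,
          λ n n' below (R , sim , r) → below-wins R sim chain region (Below⇒BelowLine C (proj₁ ρ) (proj₂ ρ) n n' below) (n , n' , refl , r)
  find-slope (flat _) wins | no ¬region = ⊥-elim (¬region tt)
  find-slope {us = u ∷ _} (steep _ _ _ chain) wins | no ¬region =
    find-slope chain (λ region n n' above → above-wins chain region ¬region (Above⇒AboveLine C (proj₁ u) (proj₂ u) n n' above))

  -- All slopes with first entry from 1 to `C` and second from 0 to `C`, without reduction to lowest
  -- terms; parallel ones are harmless since `≼` is not strict. The vertical slope is put in front
  -- separately.
  codes : List (ℕ × ℕ)
  codes = cartesianProduct (upTo C) (upTo (suc C))

  ∈-codes : ∀ {a b} → suc a ≤ C → b ≤ C → (a , b) ∈ codes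
  ∈-codes a<C b≤C = ∈-cartesianProduct⁺ (∈-upTo⁺ a<C) (∈-upTo⁺ (s≤s b≤C))

  codes-admissible : ∀ {c} → c ∈ codes → Admissible (slope c)
  codes-admissible c∈ with ∈-cartesianProduct⁻ (upTo C) (upTo (suc C)) c∈
  ... | a∈ , b∈ = (λ ()) , ∈-upTo⁻ a∈ , ℕₚ.≤-pred (∈-upTo⁻ b∈)

  -- The last hypothesis says that the list skips no code flatter than `ρ`. The opposite of a cycle
  -- effect in the negative quadrant is itself a code, hence cannot lie strictly between neighbours.
  build : ∀ ρ cs → Admissible ρ → (∀ {c} → c ∈ cs → slope c ≼ ρ) → AllPairs _⊒_ cs →
          (∀ {c} → c ∈ cs → c ∈ codes) → (∀ {c} → c ∈ codes → ρ ≼ slope c ⊎ c ∈ cs) →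
          Chain ρ (map slope cs)
  -- The code `(0 , 0)` stands for the horizontal slope `(1 , 0)`; if it is at least as steep as the
  -- final slope, then `b` is zero.
  build (a , b) [] ok _ _ _ cover with cover (∈-codes {0} {0} (s≤s z≤n) z≤n)
  ... | inj₁ b*1≤a*0 with ℕₚ.n≤0⇒n≡0 (subst (b ≤_) (ℕₚ.*-zeroʳ a) (subst (_≤ a ℕ.* 0) (ℕₚ.*-identityʳ b) b*1≤a*0))
  ... | refl = flat ok
  build ρ (c ∷ cs) ok ≼ρ (c⊒cs ∷ sorted) sub cover =
    steep ok (≼ρ (here refl)) (λ {α} → gap {α})
      (build (slope c) cs (codes-admissible (sub (here refl))) (λ d∈ → ⊒⇒≼ (lookup c⊒cs d∈)) sorted (sub ∘ there) cover′)
    where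
    cover′ : ∀ {d} → d ∈ codes → slope c ≼ slope d ⊎ d ∈ cs
    cover′ {d} d∈ with cover d∈
    ... | inj₁ ρ≼d = inj₁ (≼-trans (slope c) ρ (slope d) (proj₁ ok) (≼ρ (here refl)) ρ≼d)
    ... | inj₂ (here refl) = inj₁ (ℕₚ.≤-reflexive (ℕₚ.*-comm (proj₂ c) (suc (proj₁ c))))
    ... | inj₂ (there d∈cs) = inj₂ d∈cs

    gap : ∀ {α} → Small C α → cross (slope c) α ℤ.< 0ℤ → cross ρ α ℤ.≤ 0ℤ
    gap {α} (x≤C , y≤C) = cross-gap (slope c) ρ α (≼ρ (here refl)) between
      where
      between : ∀ x y → suc x ≤ ∣ proj₁ α ∣ → suc y ≤ ∣ proj₂ α ∣ →
                ρ ≼ (suc x , suc y) ⊎ (suc x , suc y) ≼ slope c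
      between x y x<α y<α with cover (∈-codes (ℕₚ.≤-trans x<α x≤C) (ℕₚ.≤-trans y<α y≤C))
      ... | inj₁ ρ≼ = inj₁ ρ≼
      ... | inj₂ (here refl) = inj₂ (ℕₚ.≤-reflexive (ℕₚ.*-comm (suc y) (suc x)))
      ... | inj₂ (there d∈) = inj₂ (⊒⇒≼ (lookup c⊒cs d∈))

  full-chain : Chain (0 , 1) (map slope (sort codes))
  full-chain = build (0 , 1) (sort codes) ((λ ()) , z≤n , s≤s z≤n)
    (λ {c} _ → subst (_≤ suc (proj₁ c) ℕ.* 1) (sym (ℕₚ.*-zeroʳ (proj₂ c))) z≤n)
    (Linked⇒AllPairs ⊒-trans (sort-↗ codes))
    (∈-resp-↭ (sort-↭ codes))
    (λ c∈ → inj₂ (∈-resp-↭ (↭-sym (sort-↭ codes)) c∈))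

  belt : ∀ v → ∃[ τ ] Admissible τ × Belt v τ
  -- The search starts at the vertical slope, above which there are no points.
  belt v = find-slope full-chain λ _ n n' above → ⊥-elim (¬Above-vertical C 1 n n' above)

theorem4p2 : ∀ {k k' m} (N : OCN k m) (N' : OCN k' m) →
    NonBlocking N → Complete N' →
    ∀ L → MaxAcyclicLength N N' L →
    ∀ (q : Fin k) (q' : Fin k') →
    Σ ℕ λ ρ → Σ ℕ λ ρ' →
    Positive ρ ρ'
    × (∀ n n' → Above (suc L) ρ ρ' n n' → Simulated N N' (q , n) (q' , n'))
    × (∀ n n' → Below (suc L) ρ ρ' n n' → ¬ Simulated N N' (q , n) (q' , n'))
    × ρ ≤ suc L × ρ' ≤ suc L
theorem4p2 N N' _ _ L (_ , maximal) q q' with Games.belt N N' L maximal (q , q')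
... | (ρ , ρ') , (positive , ρ≤C , ρ'≤C) , above , below = ρ , ρ' , positive , above , below , ρ≤C , ρ'≤C
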